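{- Let $G$ be a graph of order $n$ such that both $G$ and its complement $\bar G$ are connected. Then $b(G)\, b(\bar G)\leq n+4$, and equality holds if and only if $G$ is (isomorphic to) the cycle $C_5$.
   Context: Burning process on a finite graph $G$: initially all vertices are unburned. In each round, every already burned vertex spreads fire to all of its neighbors, which become burned, and at the same time one chooses an unburned vertex (if any remains) and changes its status to burned; burned vertices remain burned. The burning number $b(G)$ is the minimum number of rounds needed to burn all vertices of $G$. $\bar G$ is the complement graph of $G$. -}

module Defs where

open import Data.Fin using (Fin; toℕ)
open import Data.Fin.Properties as Fin using (any?; all?; ¬∀⟶∃¬)
open import Data.Fin.Subset using (Subset; ⊥; ⁅_⁆; _∪_; _∈_; _∉_; _⊆_; ∣_∣)
open import Data.Fin.Subset.Properties using (_∈?_; ∈⊤; ∣p∣≡n⇒p≡⊤; ∣p∣≤n; p⊂q⇒∣p∣<∣q∣; p⊆p∪q; q⊆p∪q; x∈⁅x⁆)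
open import Data.Nat using (ℕ; zero; suc; _+_; _≤_; z≤n; s≤s; _%_; _≟_)
open import Data.Nat.Properties using (≤-trans; ≤-reflexive; ≤-antisym; +-suc; +-monoʳ-≤; m≤m+n)
open import Data.Product using (∃; Σ; _×_; _,_; proj₁; proj₂; ∃-syntax)
open import Data.Sum using (_⊎_; inj₁; inj₂; swap)
open import Data.Vec using (tabulate)
open import Data.Vec.Properties using (lookup∘tabulate; lookup⇒[]=)
open import Function using (_∘_; _⇔_; _↔_; Inverse)
open import Relation.Binary.Construct.Closure.ReflexiveTransitive using (Star)
open import Relation.Binary.PropositionalEquality using (_≡_; _≢_; refl; sym; trans; subst)
open import Relation.Nullary using (¬_; Dec; yes; no; does; contradiction)
open import Relation.Nullary.Decidable using (¬?; _×-dec_; _⊎-dec_; map′; from-yes; dec-true)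

record Graph (n : ℕ) : Set₁ where
  infix 4 _~_ _~?_
  field
    _~_      : Fin n → Fin n → Set
    _~?_     : ∀ u v → Dec (u ~ v)
    ~-sym    : ∀ {u v} → u ~ v → v ~ u
    ~-irrefl : ∀ {v} → ¬ (v ~ v)

complement : ∀ {n} → Graph n → Graph n
complement G = record
  { _~_      = λ u v → u ≢ v × ¬ (u ~ v)
  ; _~?_     = λ u v → ¬? (u Fin.≟ v) ×-dec ¬? (u ~? v)
  ; ~-sym    = λ (u≢v , u≁v) → u≢v ∘ sym , u≁v ∘ ~-sym
  ; ~-irrefl = λ (v≢v , _) → v≢v refl
  }
  where open Graph G

Connected : ∀ {n} → Graph n → Set
Connected G = ∀ u v → Star (Graph._~_ G) u v

infix 4 _≅_
_≅_ : ∀ {m n} → Graph m → Graph n → Set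
_≅_ {m} {n} G H =
  Σ (Fin m ↔ Fin n) λ f → ∀ u v → (Graph._~_ G u v) ⇔ (Graph._~_ H (Inverse.to f u) (Inverse.to f v))

C₅ : Graph 5
C₅ = record
  { _~_      = λ u v → Next u v ⊎ Next v u
  ; _~?_     = λ u v → next? u v ⊎-dec next? v u
  ; ~-sym    = swap
  ; ~-irrefl = λ {v} → from-yes (all? λ w → ¬? (next? w w ⊎-dec next? w w)) v
  }
  where
  Next : Fin 5 → Fin 5 → Set
  Next u v = toℕ v ≡ suc (toℕ u) % 5

  next? : ∀ u v → Dec (Next u v)
  next? u v = toℕ v ≟ suc (toℕ u) % 5

module _ {n : ℕ} (G : Graph n) where
  open Graph G

  Reached : Subset n → Fin n → Set
  Reached B v = v ∈ B ⊎ (∃[ u ] u ∈ B × u ~ v)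

  reached? : ∀ B v → Dec (Reached B v)
  reached? B v = (v ∈? B) ⊎-dec any? (λ u → (u ∈? B) ×-dec (u ~? v))

  spread : Subset n → Subset n
  spread B = tabulate (λ v → does (reached? B v))

  AllBurned : Subset n → Set
  AllBurned B = ∀ v → v ∈ B

  -- The spreading and the choice are simultaneous, so the chosen vertex is
  -- required to be unburned at the beginning of the round.
  data Round (B : Subset n) : Subset n → Set where
    choose : ∀ v → v ∉ B → Round B (spread B ∪ ⁅ v ⁆)
    idle   : AllBurned B → Round B (spread B)

  -- BurnsFrom B k: some k successive rounds from the burned set B burn every vertex.
  data BurnsFrom (B : Subset n) : ℕ → Set where
    done : AllBurned B → BurnsFrom B zero
    step : ∀ {B′ k} → Round B B′ → BurnsFrom B′ k → BurnsFrom B (suc k)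

  BurnsIn : ℕ → Set
  BurnsIn = BurnsFrom ⊥

  IsBurningNumber : ℕ → Set
  IsBurningNumber b = BurnsIn b × (∀ k → BurnsIn k → b ≤ k)

  ⊆-spread : ∀ {B} → B ⊆ spread B
  ⊆-spread {B} {v} v∈B = lookup⇒[]= v (spread B)
    (trans (lookup∘tabulate _ v) (dec-true (reached? B v) (inj₁ v∈B)))

  allBurned? : ∀ B → Dec (AllBurned B)
  allBurned? B = all? (_∈? B)

  burnsFrom? : ∀ B k → Dec (BurnsFrom B k)
  burnsFrom? B zero = map′ done (λ { (done a) → a }) (allBurned? B)
  burnsFrom? B (suc k) = map′
    (λ { (inj₁ (v , v∉B , p)) → step (choose v v∉B) p
       ; (inj₂ (a , p)) → step (idle a) p })
    (λ { (step (choose v v∉B) p) → inj₁ (v , v∉B , p)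
       ; (step (idle a) p) → inj₂ (a , p) })
    (any? (λ v → ¬? (v ∈? B) ×-dec burnsFrom? (spread B ∪ ⁅ v ⁆) k)
      ⊎-dec (allBurned? B ×-dec burnsFrom? (spread B) k))

  allBurned⇒burnsFrom : ∀ k {B} → AllBurned B → BurnsFrom B k
  allBurned⇒burnsFrom zero    a = done a
  allBurned⇒burnsFrom (suc k) a = step (idle a) (allBurned⇒burnsFrom k (⊆-spread ∘ a))

  enough-rounds : ∀ k B → n ≤ k + ∣ B ∣ → BurnsFrom B k
  enough-rounds zero B n≤ =
    done (λ v → subst (v ∈_) (sym (∣p∣≡n⇒p≡⊤ (≤-antisym (∣p∣≤n B) n≤))) ∈⊤)
  enough-rounds (suc k) B n≤ with allBurned? B
  ... | yes a = allBurned⇒burnsFrom (suc k) a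
  ... | no ¬a with ¬∀⟶∃¬ n (_∈ B) (_∈? B) ¬a
  ...   | v , v∉B = step (choose v v∉B) (enough-rounds k _
          (≤-trans n≤ (≤-trans (≤-reflexive (sym (+-suc k ∣ B ∣)))
            (+-monoʳ-≤ k (p⊂q⇒∣p∣<∣q∣
              ( (λ x∈B → p⊆p∪q ⁅ v ⁆ (⊆-spread x∈B))
              , v , q⊆p∪q (spread B) ⁅ v ⁆ (x∈⁅x⁆ v) , v∉B))))))

least : (P : ℕ → Set) → (∀ k → Dec (P k)) → ∀ m → P m → ∃[ b ] (P b × (∀ k → P k → b ≤ k))
least P P? m pm with P? 0
... | yes p0 = 0 , p0 , λ _ _ → z≤n
least P P? zero    pm | no ¬p0 = contradiction pm ¬p0
least P P? (suc m) pm | no ¬p0 with least (P ∘ suc) (P? ∘ suc) m pm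
... | b , pb , min = suc b , pb , λ { zero p0 → contradiction p0 ¬p0 ; (suc k) pk → s≤s (min k pk) }

hasBurningNumber : ∀ {n} (G : Graph n) → ∃ (IsBurningNumber G)
hasBurningNumber {n} G =
  least (BurnsIn G) (burnsFrom? G ⊥) n (enough-rounds G n ⊥ (m≤m+n n _))

b : ∀ {n} → Graph n → ℕ
b G = proj₁ (hasBurningNumber G)

b-isBurningNumber : ∀ {n} (G : Graph n) → IsBurningNumber G (b G)
b-isBurningNumber G = proj₂ (hasBurningNumber G)

{-# OPTIONS --safe #-}
module Submission where

-- A connected graph with b(G) > r + 1 has order at least 2 + 2r + (1 + 2 + ⋯ + r): from a
-- spanning tree one cuts off branches of height r − 1, …, 1, 0, each lying in a ball around
-- its root and taking at least r, …, 2, 1 edges away, and a tree with at most 2r edges has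
-- radius at most r.  On the other hand, for every vertex x all vertices are within distance 2
-- of x in G or in its complement, so one of the two burning numbers, say q, is at most 3.
-- If p is the other one, the lower bound on the order gives p q < n + 4 whenever p ≥ 4, and
-- for p ≤ 3 the only possible exception is n = 5, p = q = 3.  Among the graphs of order 5
-- with p = q = 3 there is only C₅, which is verified on all adjacency matrices.

open import Data.Bool using (Bool; true; false; T)
open import Data.Bool.Properties using (T?; T-≡)
open import Data.Empty using (⊥-elim) renaming (⊥ to Empty)
open import Data.Fin using (Fin; zero; suc)
open import Data.Fin.Patterns using (1F; 2F; 3F)
open import Data.Fin.Permutation using (transpose; _∘ₚ_; ↔⇒≡)
open import Data.Fin.Properties using (any?; all?; ¬∀⟶∃¬; _≟_)
open import Data.Fin.Subset using (Subset; ⊥; ⁅_⁆; _∪_; _∈_; _∉_; _⊆_; ∣_∣)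
open import Data.Fin.Subset.Properties using (_∈?_; p⊆p∪q; q⊆p∪q; x∈⁅x⁆; x∈⁅y⁆⇒x≡y; x∈p∪q⁻; ∉⊥; p⊂q⇒∣p∣<∣q∣; ∣⁅x⁆∣≡1; ∣p∣≤n; anySubset?)
open import Data.Nat using (ℕ; zero; suc; _+_; _*_; _∸_; _≤_; _<_; z≤n; s≤s; _≤?_; _⊔_)
open import Data.Nat.Properties hiding (_≟_)
open import Data.Nat.Tactic.RingSolver using (solve-∀)
open import Data.Product using (∃; ∃-syntax; _×_; _,_; proj₁; proj₂; uncurry)
open import Data.Sum using (_⊎_; inj₁; inj₂; [_,_]′; map₁; map₂)
open import Data.Unit using (⊤; tt)
open import Data.Vec using (Vec; []; _∷_; map; replicate; lookup; tabulate)
open import Data.Vec.Properties using (lookup∘tabulate; lookup⇒[]=; []=⇒lookup)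
open import Function using (_∘_; _⇔_; _↔_; mk⇔; Equivalence; Inverse)
open import Function.Construct.Composition using (_⇔-∘_)
open import Function.Construct.Identity using (↔-id)
open import Function.Construct.Symmetry using (↔-sym; ⇔-sym)
open import Relation.Binary.Construct.Closure.ReflexiveTransitive using (Star; ε; _◅_)
open import Relation.Binary.PropositionalEquality using (_≡_; refl; sym; trans; cong; cong₂; subst; subst₂)
open import Relation.Nullary using (¬_; Dec; yes; no; does; contradiction)
open import Relation.Nullary.Decidable using (¬?; _×-dec_; _⊎-dec_; _→-dec_; map′; from-no; dec-true; dec-false; does-⇔; decidable-stable)
open import Defs

does-true : ∀ {A : Set} (A? : Dec A) → does A? ≡ true → A
does-true (yes a) _ = a

tri : ℕ → ℕ
tri zero    = 0
tri (suc m) = suc m + tri m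

module _ {n : ℕ} (G : Graph n) where
  open Graph G

  data Near : ℕ → Fin n → Fin n → Set where
    here  : ∀ {d u} → Near d u u
    there : ∀ {d u w v} → u ~ w → Near d w v → Near (suc d) u v

  near? : ∀ d u v → Dec (Near d u v)
  near? zero    u v = map′ (λ { refl → here }) (λ { here → refl }) (u ≟ v)
  near? (suc d) u v = map′
    (λ { (inj₁ refl) → here ; (inj₂ (_ , u~w , p)) → there u~w p })
    (λ { here → inj₁ refl ; (there u~w p) → inj₂ (_ , u~w , p) })
    ((u ≟ v) ⊎-dec any? (λ w → (u ~? w) ×-dec near? d w v))

  near-mono : ∀ {d e u v} → d ≤ e → Near d u v → Near e u v
  near-mono _         here          = here
  near-mono (s≤s d≤e) (there u~w p) = there u~w (near-mono d≤e p)

  near-trans : ∀ {d e u w v} → Near d u w → Near e w v → Near (d + e) u v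
  near-trans {d} {e} here q = near-mono (m≤n+m e d) q
  near-trans (there u~w p) q = there u~w (near-trans p q)

  near-sym : ∀ {d u v} → Near d u v → Near d v u
  near-sym here = here
  near-sym {suc d} (there u~w p) =
    near-mono (≤-reflexive (+-comm d 1)) (near-trans (near-sym p) (there (~-sym u~w) here))

  -- The i-th of k centres is ignited in round i, so it burns its ball of radius k − i.
  Covered : ∀ {k} → Vec (Fin n) k → Fin n → Set
  Covered []               v = Empty
  Covered {suc k} (c ∷ cs) v = Near k c v ⊎ Covered cs v

  covered? : ∀ {k} (cs : Vec (Fin n) k) v → Dec (Covered cs v)
  covered? []               v = no λ ()
  covered? {suc k} (c ∷ cs) v = near? k c v ⊎-dec covered? cs v

  ∈-spread⁺ : ∀ {B v} → Reached G B v → v ∈ spread G B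
  ∈-spread⁺ {B} {v} r =
    lookup⇒[]= v _ (trans (lookup∘tabulate _ v) (dec-true (reached? G B v) r))

  ∈-spread⁻ : ∀ {B v} → v ∈ spread G B → Reached G B v
  ∈-spread⁻ {B} {v} v∈ =
    does-true (reached? G B v) (trans (sym (lookup∘tabulate _ v)) ([]=⇒lookup v∈))

  round-igniting : ∀ B c → ∃[ B′ ] Round G B B′ × spread G B ⊆ B′ × c ∈ B′
  round-igniting B c with c ∈? B
  ... | no c∉B = _ , choose c c∉B , p⊆p∪q ⁅ c ⁆ , q⊆p∪q (spread G B) ⁅ c ⁆ (x∈⁅x⁆ c)
  ... | yes c∈B with allBurned? G B
  ...   | yes a = _ , idle a , (λ x∈ → x∈) , ⊆-spread G c∈B
  ...   | no ¬a with ¬∀⟶∃¬ n (_∈ B) (_∈? B) ¬a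
  ...     | v , v∉B = _ , choose v v∉B , p⊆p∪q ⁅ v ⁆ , p⊆p∪q ⁅ v ⁆ (⊆-spread G c∈B)

  covered⇒burnsFrom : ∀ {k} (cs : Vec (Fin n) k) B →
    (∀ v → (∃[ u ] u ∈ B × Near k u v) ⊎ Covered cs v) → BurnsFrom G B k
  covered⇒burnsFrom [] B cov = done λ v → [ (λ { (_ , u∈B , here) → u∈B }) , ⊥-elim ]′ (cov v)
  covered⇒burnsFrom {suc k} (c ∷ cs) B cov with round-igniting B c
  ... | B′ , round , spread⊆B′ , c∈B′ = step round (covered⇒burnsFrom cs B′ (next ∘ cov))
    where
    next : ∀ {v} → (∃[ u ] u ∈ B × Near (suc k) u v) ⊎ Covered (c ∷ cs) v →
      (∃[ u ] u ∈ B′ × Near k u v) ⊎ Covered cs v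
    next (inj₁ (u , u∈B , here))        = inj₁ (u , spread⊆B′ (⊆-spread G u∈B) , here)
    next (inj₁ (u , u∈B , there u~w p)) = inj₁ (_ , spread⊆B′ (∈-spread⁺ (inj₂ (u , u∈B , u~w))) , p)
    next (inj₂ (inj₁ p))                = inj₁ (c , c∈B′ , p)
    next (inj₂ (inj₂ p))                = inj₂ p

  covered⇒burnsIn : ∀ {k} (cs : Vec (Fin n) k) → (∀ v → Covered cs v) → BurnsIn G k
  covered⇒burnsIn cs cov = covered⇒burnsFrom cs ⊥ (inj₂ ∘ cov)

  near-spread : ∀ {B k v} → (∃[ u ] u ∈ spread G B × Near k u v) → ∃[ u ] u ∈ B × Near (suc k) u v
  near-spread (u , u∈ , p) with ∈-spread⁻ u∈
  ... | inj₁ u∈B             = u , u∈B , near-mono (n≤1+n _) p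
  ... | inj₂ (w , w∈B , w~u) = w , w∈B , there w~u p

  burnsFrom⇒covered : ∀ {B k} → Fin n → BurnsFrom G B k →
    ∃[ cs ] ∀ v → (∃[ u ] u ∈ B × Near k u v) ⊎ Covered {k} cs v
  burnsFrom⇒covered x (done a) = [] , λ v → inj₁ (v , a v , here)
  burnsFrom⇒covered x (step (idle a) _) = replicate _ x , λ v → inj₁ (v , a v , here)
  burnsFrom⇒covered {B} x (step {k = k} (choose c _) p) with burnsFrom⇒covered x p
  ... | cs , cov = c ∷ cs , before ∘ cov
    where
    before : ∀ {v} → (∃[ u ] u ∈ spread G B ∪ ⁅ c ⁆ × Near k u v) ⊎ Covered cs v →
      (∃[ u ] u ∈ B × Near (suc k) u v) ⊎ Covered (c ∷ cs) v
    before (inj₂ q) = inj₂ (inj₂ q)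
    before (inj₁ (u , u∈ , q)) with x∈p∪q⁻ (spread G B) ⁅ c ⁆ u∈
    ... | inj₁ u∈spread = inj₁ (near-spread (u , u∈spread , q))
    ... | inj₂ u∈⁅c⁆ with x∈⁅y⁆⇒x≡y c u∈⁅c⁆
    ...   | refl = inj₂ (inj₁ q)

  burnsIn⇒covered : ∀ {k} → Fin n → BurnsIn G k → ∃[ cs ] ∀ v → Covered {k} cs v
  burnsIn⇒covered x p with burnsFrom⇒covered x p
  ... | cs , cov = cs , λ v → [ (λ (_ , u∈⊥ , _) → contradiction u∈⊥ ∉⊥) , (λ q → q) ]′ (cov v)

  burnsIn⇒b≤ : ∀ {k} → BurnsIn G k → b G ≤ k
  burnsIn⇒b≤ = proj₂ (b-isBurningNumber G) _

  eccentricity≤⇒burnsIn : ∀ r x → (∀ v → Near r x v) → BurnsIn G (suc r)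
  eccentricity≤⇒burnsIn r x near = covered⇒burnsIn (x ∷ replicate r x) (inj₁ ∘ near)

  infix 4 _∈ₜ_

  -- A tree in G with a given root, in first-child/next-sibling form.
  data Tree : Fin n → Set where
    leaf  : ∀ {u} → Tree u
    graft : ∀ {u w} → u ~ w → Tree w → Tree u → Tree u

  data _∈ₜ_ (x : Fin n) : ∀ {u} → Tree u → Set where
    root  : x ∈ₜ leaf {x}
    child : ∀ {u w s t} {e : u ~ w} → x ∈ₜ s → x ∈ₜ graft e s t
    rest  : ∀ {u w s t} {e : u ~ w} → x ∈ₜ t → x ∈ₜ graft e s t

  edges : ∀ {u} → Tree u → ℕ
  edges leaf          = 0
  edges (graft _ s t) = suc (edges s + edges t)

  height : ∀ {u} → Tree u → ℕ
  height leaf          = 0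
  height (graft _ s t) = suc (height s) ⊔ height t

  root∈ : ∀ {u} (t : Tree u) → u ∈ₜ t
  root∈ leaf          = root
  root∈ (graft _ _ t) = rest (root∈ t)

  height≤edges : ∀ {u} (t : Tree u) → height t ≤ edges t
  height≤edges leaf          = z≤n
  height≤edges (graft _ s t) = ⊔-lub
    (s≤s (≤-trans (height≤edges s) (m≤m+n _ _)))
    (≤-trans (height≤edges t) (m≤n+m _ (suc (edges s))))

  near-root : ∀ {u x} {t : Tree u} → x ∈ₜ t → Near (height t) u x
  near-root root = here
  near-root (child {s = s} {t} {e} x∈s) = near-mono (m≤m⊔n (suc (height s)) (height t)) (there e (near-root x∈s))
  near-root (rest {s = s} {t} x∈t) = near-mono (m≤n⊔m (suc (height s)) (height t)) (near-root x∈t)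

  near-within : ∀ {u x y} {t : Tree u} → x ∈ₜ t → y ∈ₜ t → Near (edges t) x y
  near-within root root = here
  near-within (child x∈s) (child y∈s) =
    near-mono (≤-trans (m≤m+n _ _) (n≤1+n _)) (near-within x∈s y∈s)
  near-within (rest {s = s} x∈t) (rest y∈t) =
    near-mono (m≤n+m _ (suc (edges s))) (near-within x∈t y∈t)
  near-within (child {s = s} {t} {e} x∈s) (rest y∈t) =
    near-mono (≤-reflexive (+-suc (edges s) (edges t)))
      (near-trans (near-within x∈s (root∈ s)) (there (~-sym e) (near-within (root∈ t) y∈t)))
  near-within (rest {s = s} {t} {e} x∈t) (child y∈s) =
    near-mono (≤-reflexive (+-comm (edges t) (suc (edges s))))
      (near-trans (near-within x∈t (root∈ t)) (there e (near-within (root∈ s) y∈s)))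

  attach : ∀ {u p y} {t : Tree u} → p ∈ₜ t → p ~ y →
    ∃[ t′ ] edges t′ ≡ suc (edges t) × y ∈ₜ t′ × (∀ {x} → x ∈ₜ t → x ∈ₜ t′)
  attach root p~y = graft p~y leaf leaf , refl , child root , rest
  attach (child {t = t} {e} p∈s) p~y with attach p∈s p~y
  ... | s′ , size , y∈s′ , s⊆s′ = graft e s′ t , cong (λ m → suc (m + edges t)) size , child y∈s′ ,
    λ { (child x∈s) → child (s⊆s′ x∈s) ; (rest x∈t) → rest x∈t }
  attach (rest {s = s} {e = e} p∈t) p~y with attach p∈t p~y
  ... | t′ , size , y∈t′ , t⊆t′ = graft e s t′ , cong suc (trans (cong (edges s +_) size) (+-suc _ _)) , rest y∈t′ ,
    λ { (child x∈s) → child x∈s ; (rest x∈t) → rest (t⊆t′ x∈t) }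

  leaving-edge : ∀ {u v} {B : Subset n} → Star _~_ u v → u ∈ B → v ∉ B →
    ∃[ p ] ∃[ y ] p ∈ B × y ∉ B × p ~ y
  leaving-edge ε u∈B v∉B = contradiction u∈B v∉B
  leaving-edge {B = B} (_◅_ {j = w} u~w path) u∈B v∉B with w ∈? B
  ... | yes w∈B = leaving-edge path w∈B v∉B
  ... | no  w∉B = _ , w , u∈B , w∉B , u~w

  grow : Connected G → ∀ k {u} (t : Tree u) (B : Subset n) → u ∈ B → (∀ {x} → x ∈ B → x ∈ₜ t) →
    edges t < ∣ B ∣ → n ≤ k + ∣ B ∣ → ∃[ t′ ] edges t′ < n × (∀ x → _∈ₜ_ x {u} t′)
  grow conn k {u} t B u∈B B⊆t size n≤ with allBurned? G B
  ... | yes a = t , ≤-trans size (∣p∣≤n B) , λ x → B⊆t (a x)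
  ... | no ¬a with ¬∀⟶∃¬ n (_∈ B) (_∈? B) ¬a
  ...   | v , v∉B with leaving-edge (conn u v) u∈B v∉B
  ...     | p , y , p∈B , y∉B , p~y with attach (B⊆t p∈B) p~y | larger
    where
    larger : ∣ B ∣ < ∣ B ∪ ⁅ y ⁆ ∣
    larger = p⊂q⇒∣p∣<∣q∣ (p⊆p∪q ⁅ y ⁆ , y , q⊆p∪q B ⁅ y ⁆ (x∈⁅x⁆ y) , y∉B)
  grow conn zero t B _ _ _ n≤ | no _ | _ | _ , y , _ | _ | larger =
    contradiction (≤-trans larger (∣p∣≤n (B ∪ ⁅ y ⁆))) (≤⇒≯ n≤)
  grow conn (suc k) t B u∈B B⊆t size n≤ | no _ | _ | _ , y , _ | t′ , size′ , y∈t′ , t⊆t′ | larger =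
    grow conn k t′ (B ∪ ⁅ y ⁆) (p⊆p∪q ⁅ y ⁆ u∈B)
      (λ x∈ → [ t⊆t′ ∘ B⊆t , (λ x∈y → subst (_∈ₜ t′) (sym (x∈⁅y⁆⇒x≡y y x∈y)) y∈t′) ]′ (x∈p∪q⁻ B ⁅ y ⁆ x∈))
      (subst (_< _) (sym size′) (≤-<-trans size larger))
      (≤-trans n≤ (≤-trans (≤-reflexive (sym (+-suc k _))) (+-monoʳ-≤ k larger)))

  spanning-tree : Connected G → ∀ u → ∃[ t ] edges t < n × (∀ x → _∈ₜ_ x {u} t)
  spanning-tree conn u = grow conn n leaf ⁅ u ⁆ (x∈⁅x⁆ u)
    (λ x∈ → subst (_∈ₜ leaf) (sym (x∈⁅y⁆⇒x≡y u x∈)) root)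
    (≤-reflexive (sym (∣⁅x⁆∣≡1 u))) (m≤m+n n _)

  -- A branch of height exactly r has been cut off from t; `centre` is its root and `stem` the
  -- vertex it hung from.
  record Pruned (r : ℕ) {u} (t : Tree u) : Set where
    constructor pruned
    field
      {remainder}  : Tree u
      {stem}       : Fin n
      {centre}     : Fin n
      stem∈        : stem ∈ₜ remainder
      stem~centre  : stem ~ centre
      edges-lost   : edges remainder + suc r ≤ edges t
      split        : ∀ {x} → x ∈ₜ t → x ∈ₜ remainder ⊎ Near r centre x

  prune : ∀ r {u} (t : Tree u) → height t ≤ r ⊎ Pruned r t
  prune r leaf = inj₁ z≤n
  prune r (graft e s t) with prune r s | suc (height s) ≤? r | prune r t
  ... | inj₂ (pruned {s′} p∈ p~c lost split) | _ | _ = inj₂ (pruned {remainder = graft e s′ t} (child p∈) p~c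
    (≤-trans (≤-reflexive (swap-last (edges s′) (edges t) r)) (s≤s (+-monoˡ-≤ (edges t) lost)))
    λ { (child x∈s) → map₁ child (split x∈s) ; (rest x∈t) → inj₁ (rest x∈t) })
    where
    swap-last : ∀ i j k → suc (i + j) + suc k ≡ suc (i + suc k + j)
    swap-last = solve-∀
  ... | inj₁ s≤r | no s≮r | _ = inj₂ (pruned (root∈ t) e
    (≤-trans (≤-reflexive (+-comm (edges t) (suc r))) (s≤s (+-monoˡ-≤ (edges t) (≤-trans (≮⇒≥ s≮r) (height≤edges s)))))
    λ { (child x∈s) → inj₂ (near-mono s≤r (near-root x∈s)) ; (rest x∈t) → inj₁ x∈t })
  ... | inj₁ _ | yes s<r | inj₁ t≤r = inj₁ (⊔-lub s<r t≤r)
  ... | inj₁ _ | yes _ | inj₂ (pruned {t′} p∈ p~c lost split) = inj₂ (pruned {remainder = graft e s t′} (rest p∈) p~c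
    (s≤s (≤-trans (≤-reflexive (+-assoc (edges s) _ _)) (+-monoʳ-≤ (edges s) lost)))
    λ { (child x∈s) → inj₁ (child x∈s) ; (rest x∈t) → map₁ rest (split x∈t) })

  tree-centre : ∀ r {u} (t : Tree u) → edges t ≤ r + r → ∃[ c ] (∀ {x} → x ∈ₜ t → Near r c x)
  tree-centre r {u} t size with prune r t
  ... | inj₁ t≤r = u , λ x∈t → near-mono t≤r (near-root x∈t)
  ... | inj₂ (pruned {t′} {_} {c} p∈ p~c lost split) = c , λ x∈t →
    [ (λ x∈t′ → near-mono t′<r (there (~-sym p~c) (near-within p∈ x∈t′))) , (λ q → q) ]′ (split x∈t)
    where
    t′<r : edges t′ < r
    t′<r = +-cancelʳ-≤ r _ r (≤-trans (≤-reflexive (sym (+-suc (edges t′) r))) (≤-trans lost size))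

  prune-or-finish : ∀ r {u} (t : Tree u) → ∃[ c ] ∃[ t′ ] edges t′ ≤ edges t ∸ suc r ×
    (∀ {x} → x ∈ₜ t → _∈ₜ_ x {u} t′ ⊎ Near r c x)
  prune-or-finish r {u} t with prune r t
  ... | inj₁ t≤r = u , leaf , z≤n , λ x∈t → inj₂ (near-mono t≤r (near-root x∈t))
  ... | inj₂ (pruned _ _ lost split) = _ , _ , m+n≤o⇒m≤o∸n _ lost , split

  prune-repeatedly : ∀ m {u} (t : Tree u) → ∃[ cs ] ∃[ t′ ] edges t′ ≤ edges t ∸ tri m ×
    (∀ {x} → x ∈ₜ t → _∈ₜ_ x {u} t′ ⊎ Covered {m} cs x)
  prune-repeatedly zero    t = [] , t , ≤-refl , inj₁
  prune-repeatedly (suc m) t with prune-or-finish m t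
  ... | c , t₁ , size₁ , split₁ with prune-repeatedly m t₁
  ...   | cs , t₂ , size₂ , split₂ = c ∷ cs , t₂
    , ≤-trans size₂ (≤-trans (∸-monoˡ-≤ (tri m) size₁) (≤-reflexive (∸-+-assoc (edges t) (suc m) (tri m))))
    , λ x∈t → [ map₂ inj₂ ∘ split₂ , inj₂ ∘ inj₁ ]′ (split₁ x∈t)

  order≤⇒burnsIn : Connected G → Fin n → ∀ r → n ≤ suc (r + r + tri r) → BurnsIn G (suc r)
  order≤⇒burnsIn conn u r n≤ with spanning-tree conn u
  ... | t , size , all∈t with prune-repeatedly r t
  ...   | cs , t′ , size′ , split with tree-centre r t′ (≤-trans size′
            (m≤n+o⇒m∸n≤o _ (tri r) (≤-trans (≤-pred (≤-trans size n≤)) (≤-reflexive (+-comm (r + r) (tri r))))))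
  ...     | c , near = covered⇒burnsIn (c ∷ cs) (λ v → map₁ near (split (all∈t v)))

order-bound : ∀ {n} (G : Graph n) → Connected G → Fin n → ∀ r → 2 + r ≤ b G → 2 + (r + r + tri r) ≤ n
order-bound G conn u r 2+r≤b = ≰⇒> λ n≤ →
  <⇒≱ 2+r≤b (burnsIn⇒b≤ G (order≤⇒burnsIn G conn u r n≤))

-- A vertex v at distance more than 2 from x has no common neighbour with x, so in the
-- complement every vertex is adjacent to x or to its neighbour v.
near₂-or-complement : ∀ {n} (G : Graph n) x →
  (∀ v → Near G 2 x v) ⊎ (∀ v → Near (complement G) 2 x v)
near₂-or-complement {n} G x with all? (near? G 2 x)
... | yes near = inj₁ near
... | no ¬near with ¬∀⟶∃¬ n (Near G 2 x) (near? G 2 x) ¬near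
...   | v , far = inj₂ near
  where
  open Graph G
  near : ∀ w → Near (complement G) 2 x w
  near w with x ≟ w | x ~? w
  ... | yes refl | _      = here
  ... | no x≢w   | no x≁w = there (x≢w , x≁w) here
  ... | no _     | yes x~w = there ((λ { refl → far here }) , λ x~v → far (there x~v here))
    (there ((λ { refl → far (there x~w here) }) , λ v~w → far (there x~w (there (~-sym v~w) here))) here)

b≤3-or-complement : ∀ {n} (G : Graph n) → Fin n → b G ≤ 3 ⊎ b (complement G) ≤ 3
b≤3-or-complement G x = [ inj₁ ∘ small G , inj₂ ∘ small (complement G) ]′ (near₂-or-complement G x)
  where
  small : ∀ {n} (H : Graph n) {x} → (∀ v → Near H 2 x v) → b H ≤ 3
  small H near = burnsIn⇒b≤ H (eccentricity≤⇒burnsIn H 2 _ near)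

module _ (n : ℕ) where

  Large : ℕ → Set
  Large p = ∀ r → 2 + r ≤ p → 2 + (r + r + tri r) ≤ n

  StrictOrFive : ℕ → ℕ → Set
  StrictOrFive p q = p * q < n + 4 ⊎ (n ≡ 5 × p ≡ 3 × q ≡ 3)

  small-products : ∀ p q → 0 < n → Large p → Large q → p ≤ 3 → q ≤ 3 → StrictOrFive p q
  small-products p q 0<n lp lq p≤3 q≤3 with m≤n⇒m<n∨m≡n p≤3 | m≤n⇒m<n∨m≡n q≤3
  ... | inj₁ p<3 | inj₁ q<3 = inj₁ (≤-<-trans (*-mono-≤ (≤-pred p<3) (≤-pred q<3)) (+-monoˡ-≤ 4 0<n))
  ... | inj₁ p<3 | inj₂ refl = inj₁ (≤-<-trans (*-monoˡ-≤ 3 (≤-pred p<3)) (≤-trans (m≤n+m 7 2) (+-monoˡ-≤ 4 (lq 1 ≤-refl))))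
  ... | inj₂ refl | inj₁ q<3 = inj₁ (≤-<-trans (*-monoʳ-≤ 3 (≤-pred q<3)) (≤-trans (m≤n+m 7 2) (+-monoˡ-≤ 4 (lp 1 ≤-refl))))
  ... | inj₂ refl | inj₂ refl with m≤n⇒m<n∨m≡n (lp 1 ≤-refl)
  ...   | inj₁ 5<n = inj₁ (+-monoˡ-≤ 4 5<n)
  ...   | inj₂ refl = inj₂ (refl , refl , refl)

  large-product : ∀ s q → Large (4 + s) → q ≤ 3 → (4 + s) * q < n + 4
  large-product s q lp q≤3 = ≤-<-trans (*-monoʳ-≤ (4 + s) q≤3)
    (≤-trans (≤-trans (m≤m+n _ (s + tri s)) (≤-reflexive (slack s (tri s)))) (+-monoˡ-≤ 4 (lp (2 + s) ≤-refl)))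
    where
    slack : ∀ s t → suc ((4 + s) * 3) + (s + t) ≡ 2 + ((2 + s) + (2 + s) + ((2 + s) + ((1 + s) + t))) + 4
    slack = solve-∀

  products-q≤3 : ∀ p q → 0 < n → Large p → Large q → q ≤ 3 → StrictOrFive p q
  products-q≤3 p q 0<n lp lq q≤3 with p ≤? 3
  ... | yes p≤3 = small-products p q 0<n lp lq p≤3 q≤3
  ... | no p≰3 with m≤n⇒∃[o]m+o≡n (≰⇒> p≰3)
  ...   | s , refl = inj₁ (large-product s q lp q≤3)

  products : ∀ p q → 0 < n → Large p → Large q → p ≤ 3 ⊎ q ≤ 3 → StrictOrFive p q
  products p q 0<n lp lq (inj₂ q≤3) = products-q≤3 p q 0<n lp lq q≤3
  products p q 0<n lp lq (inj₁ p≤3) with products-q≤3 q p 0<n lq lp p≤3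
  ... | inj₁ lt                  = inj₁ (subst (_< n + 4) (*-comm q p) lt)
  ... | inj₂ (n≡5 , q≡3 , p≡3) = inj₂ (n≡5 , p≡3 , q≡3)

strict-or-five : ∀ n (G : Graph n) → Connected G → Connected (complement G) →
  StrictOrFive n (b G) (b (complement G))
strict-or-five zero G _ _ =
  inj₁ (s≤s (≤-trans (*-monoˡ-≤ (b (complement G)) (burnsIn⇒b≤ G {0} (done λ ()))) z≤n))
strict-or-five (suc n) G conn conn′ = products (suc n) (b G) (b (complement G)) (s≤s z≤n)
  (order-bound G conn zero) (order-bound (complement G) conn′ zero) (b≤3-or-complement G zero)

≅-sym : ∀ {m n} {G : Graph m} {H : Graph n} → G ≅ H → H ≅ G
≅-sym {H = H} (f , adj) = ↔-sym f , λ u v → ⇔-sym (adj (from u) (from v)) ⇔-∘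
  mk⇔ (subst₂ (Graph._~_ H) (sym (strictlyInverseˡ u)) (sym (strictlyInverseˡ v)))
      (subst₂ (Graph._~_ H) (strictlyInverseˡ u) (strictlyInverseˡ v))
  where open Inverse f

≅-trans : ∀ {l m n} {G : Graph l} {H : Graph m} {K : Graph n} → G ≅ H → H ≅ K → G ≅ K
≅-trans (f , adj) (g , adj′) = f ∘ₚ g , λ u v → adj′ _ _ ⇔-∘ adj u v

complement-cong : ∀ {m n} {G : Graph m} {H : Graph n} → G ≅ H → complement G ≅ complement H
complement-cong (f , adj) = f , λ u v → mk⇔
  (λ (u≢v , u≁v) → (λ eq → u≢v (trans (sym (strictlyInverseʳ u)) (trans (cong from eq) (strictlyInverseʳ v))))
                 , u≁v ∘ Equivalence.from (adj u v))
  (λ (fu≢fv , fu≁fv) → fu≢fv ∘ cong to , fu≁fv ∘ Equivalence.to (adj u v))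
  where open Inverse f

module _ {m n : ℕ} {G : Graph m} {H : Graph n} (G≅H : G ≅ H) where
  open Inverse (proj₁ G≅H)

  near-cong : ∀ {d u v} → Near G d u v → Near H d (to u) (to v)
  near-cong here          = here
  near-cong (there u~w p) = there (Equivalence.to (proj₂ G≅H _ _) u~w) (near-cong p)

  covered-cong : ∀ {k} (cs : Vec (Fin m) k) {v} → Covered G cs v → Covered H (map to cs) (to v)
  covered-cong (c ∷ cs) (inj₁ p) = inj₁ (near-cong p)
  covered-cong (c ∷ cs) (inj₂ p) = inj₂ (covered-cong cs p)

  burnsIn-cong : Fin m → ∀ {k} → BurnsIn G k → BurnsIn H k
  burnsIn-cong x p with burnsIn⇒covered G x p
  ... | cs , cov = covered⇒burnsIn H (map to cs) λ v →
    subst (Covered H (map to cs)) (strictlyInverseˡ v) (covered-cong cs (cov (from v)))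

  b-mono : Fin m → b H ≤ b G
  b-mono x = burnsIn⇒b≤ H (burnsIn-cong x (proj₁ (b-isBurningNumber G)))

b-cong : ∀ {m n} {G : Graph m} {H : Graph n} → G ≅ H → Fin m → b G ≡ b H
b-cong {G = G} {H} G≅H x = ≤-antisym (b-mono (≅-sym {G = G} {H} G≅H) (Inverse.to (proj₁ G≅H) x)) (b-mono G≅H x)

-- The part of a symmetric adjacency matrix strictly above the diagonal, row by row.
Table : ℕ → Set
Table zero    = ⊤
Table (suc n) = Subset n × Table n

entry : ∀ {n} → Table n → Fin n → Fin n → Bool
entry (r , t) zero    zero    = false
entry (r , t) zero    (suc j) = lookup r j
entry (r , t) (suc i) zero    = lookup r i
entry (r , t) (suc i) (suc j) = entry t i j

entry-sym : ∀ {n} (t : Table n) i j → entry t i j ≡ entry t j i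
entry-sym (r , t) zero    zero    = refl
entry-sym (r , t) zero    (suc j) = refl
entry-sym (r , t) (suc i) zero    = refl
entry-sym (r , t) (suc i) (suc j) = entry-sym t i j

entry-irrefl : ∀ {n} (t : Table n) i → entry t i i ≡ false
entry-irrefl (r , t) zero    = refl
entry-irrefl (r , t) (suc i) = entry-irrefl t i

fromTable : ∀ {n} → Table n → Graph n
fromTable t = record
  { _~_      = λ i j → T (entry t i j)
  ; _~?_     = λ i j → T? (entry t i j)
  ; ~-sym    = λ {i} {j} → subst T (entry-sym t i j)
  ; ~-irrefl = λ {i} → subst T (entry-irrefl t i)
  }

delete-first : ∀ {n} → Graph (suc n) → Graph n
delete-first G = record
  { _~_ = λ i j → suc i ~ suc j ; _~?_ = λ i j → suc i ~? suc j ; ~-sym = ~-sym ; ~-irrefl = ~-irrefl }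
  where open Graph G

toTable : ∀ {n} → Graph n → Table n
toTable {zero}  G = tt
toTable {suc n} G = tabulate (λ j → does (Graph._~?_ G zero (suc j))) , toTable (delete-first G)

entry-toTable : ∀ {n} (G : Graph n) i j → entry (toTable G) i j ≡ does (Graph._~?_ G i j)
entry-toTable G zero    zero    = sym (dec-false (Graph._~?_ G zero zero) (Graph.~-irrefl G))
entry-toTable G zero    (suc j) = lookup∘tabulate _ j
entry-toTable G (suc i) zero    = trans (lookup∘tabulate _ i)
  (does-⇔ (mk⇔ (Graph.~-sym G) (Graph.~-sym G)) (Graph._~?_ G zero (suc i)) (Graph._~?_ G (suc i) zero))
entry-toTable G (suc i) (suc j) = entry-toTable (delete-first G) i j

fromTable-toTable : ∀ {n} (G : Graph n) → G ≅ fromTable (toTable G)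
fromTable-toTable G = ↔-id _ , λ i j → mk⇔
  (λ i~j → Equivalence.from T-≡ (trans (entry-toTable G i j) (dec-true (i ~? j) i~j)))
  (λ t → does-true (i ~? j) (trans (sym (entry-toTable G i j)) (Equivalence.to T-≡ t)))
  where open Graph G

anyTable? : ∀ n {P : Table n → Set} → (∀ t → Dec (P t)) → Dec (∃ P)
anyTable? zero    P? = map′ (λ p → tt , p) proj₂ (P? tt)
anyTable? (suc n) P? = map′ (λ (r , t , p) → (r , t) , p) (λ ((r , t) , p) → r , t , p)
  (anySubset? λ r → anyTable? n λ t → P? (r , t))

BurnsInTwo : ∀ {n} → Graph n → Set
BurnsInTwo G = ∃[ x ] ∃[ y ] ∀ v → Covered G (x ∷ y ∷ []) v

burnsInTwo? : ∀ {n} (G : Graph n) → Dec (BurnsInTwo G)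
burnsInTwo? G = any? λ x → any? λ y → all? (covered? G (x ∷ y ∷ []))

-- By the rotational symmetry of C₅ it is enough to try the labellings that fix vertex 0.
labelling : Fin 5 → Fin 5 → Fin 5 → Fin 5 ↔ Fin 5
labelling j k l = transpose 1F j ∘ₚ transpose 2F k ∘ₚ transpose 3F l

IsC₅ : Graph 5 → Set
IsC₅ G = ∃[ j ] ∃[ k ] ∃[ l ] ∀ u v →
  (u ~ v → to (labelling j k l) u ~₅ to (labelling j k l) v) ×
  (to (labelling j k l) u ~₅ to (labelling j k l) v → u ~ v)
  where
  open Graph G
  open Graph C₅ renaming (_~_ to _~₅_)
  open Inverse using (to)

isC₅? : ∀ G → Dec (IsC₅ G)
isC₅? G = any? λ j → any? λ k → any? λ l → all? λ u → all? λ v →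
  ((u ~? v) →-dec (to (labelling j k l) u ~₅? to (labelling j k l) v)) ×-dec
  ((to (labelling j k l) u ~₅? to (labelling j k l) v) →-dec (u ~? v))
  where
  open Graph G
  open Graph C₅ renaming (_~?_ to _~₅?_)
  open Inverse using (to)

isC₅⇒≅ : ∀ {G} → IsC₅ G → G ≅ C₅
isC₅⇒≅ (j , k , l , adj) = labelling j k l , λ u v → uncurry mk⇔ (adj u v)

Counterexample : Table 5 → Set
Counterexample t =
  ¬ BurnsInTwo (fromTable t) × ¬ BurnsInTwo (complement (fromTable t)) × ¬ IsC₅ (fromTable t)

no-counterexample : ¬ ∃ Counterexample
no-counterexample = from-no (anyTable? 5 λ t →
  ¬? (burnsInTwo? (fromTable t)) ×-dec ¬? (burnsInTwo? (complement (fromTable t))) ×-dec ¬? (isC₅? (fromTable t)))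

b≡3⇒¬burnsInTwo : ∀ {m n} {G : Graph m} {H : Graph n} → G ≅ H → b G ≡ 3 → ¬ BurnsInTwo H
b≡3⇒¬burnsInTwo {G = G} {H} G≅H bG≡3 (x , y , cov) = <⇒≱ (≤-reflexive (sym bG≡3))
  (≤-trans (b-mono (≅-sym {G = G} {H} G≅H) x) (burnsIn⇒b≤ H (covered⇒burnsIn H (x ∷ y ∷ []) cov)))

five⇒≅C₅ : (G : Graph 5) → b G ≡ 3 → b (complement G) ≡ 3 → G ≅ C₅
five⇒≅C₅ G p≡3 q≡3 = ≅-trans {G = G} {H} {C₅} G≅H (isC₅⇒≅ {H} (decidable-stable (isC₅? H) λ ¬iso →
  no-counterexample (toTable G , b≡3⇒¬burnsInTwo {G = G} {H} G≅H p≡3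
    , b≡3⇒¬burnsInTwo {G = complement G} {complement H} (complement-cong {G = G} {H} G≅H) q≡3 , ¬iso)))
  where
  H   = fromTable (toTable G)
  G≅H = fromTable-toTable G

b-C₅ : b C₅ * b (complement C₅) ≡ 9
b-C₅ = refl

≅C₅⇒product : ∀ {n} (G : Graph n) → G ≅ C₅ → b G * b (complement G) ≡ n + 4
≅C₅⇒product G iso@(f , _) = trans
  (cong₂ _*_ (b-cong {G = G} {C₅} iso x) (b-cong {G = complement G} {complement C₅} (complement-cong {G = G} {C₅} iso) x))
  (trans b-C₅ (cong (_+ 4) (sym (↔⇒≡ f))))
  where x = Inverse.from f zero

product⇒≅C₅ : ∀ {n} (G : Graph n) → StrictOrFive n (b G) (b (complement G)) →
  b G * b (complement G) ≡ n + 4 → G ≅ C₅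
product⇒≅C₅ G (inj₁ lt)                 eq = contradiction eq (<⇒≢ lt)
product⇒≅C₅ G (inj₂ (refl , p≡3 , q≡3)) _  = five⇒≅C₅ G p≡3 q≡3

product-bound : ∀ n p q → StrictOrFive n p q → p * q ≤ n + 4
product-bound n p q (inj₁ lt)                   = <⇒≤ lt
product-bound n p q (inj₂ (refl , refl , refl)) = ≤-refl

theorem2 : ∀ (n : ℕ) (G : Graph n) → Connected G → Connected (complement G) →
    (b G * b (complement G) ≤ n + 4) × ((b G * b (complement G) ≡ n + 4) ⇔ (G ≅ C₅))
theorem2 n G conn conn′ =
  product-bound n (b G) (b (complement G)) bound , mk⇔ (product⇒≅C₅ G bound) (≅C₅⇒product G)
  where bound = strict-or-five n G conn conn′
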